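{- If $A,B$ are nonempty sets of vertices in the hypercube $\mathbb{H}_d$ and $C$ is the convex closure of $\widehat{m}(A,B)$, then $A\cup B\subseteq C$.
   Context: $\mathbb{H}_d$ is the hypercube: its points are the subsets of $\{1,\ldots,d\}$, with distance $d(\gamma,\gamma')=|\gamma\triangle\gamma'|$. For points $a,b$, $$\widehat{m}(a,b)=\{u: d(a,u)=\lfloor d(a,b)/2\rfloor,\ d(a,u)+d(u,b)=d(a,b)\}\cup\{u: d(a,u)=\lceil d(a,b)/2\rceil,\ d(a,u)+d(u,b)=d(a,b)\},$$ and $\widehat{m}(S,T)=\bigcup_{s\in S,t\in T}\widehat{m}(s,t)$. A set $S$ is convex if $\widehat{m}(S,S)\subseteq S$. The convex closure of a set is the smallest convex set containing it (the intersection of all convex sets containing it). -}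

module Defs where

open import Level using (Level; suc; _⊔_)
open import Data.Nat.Base using (ℕ; _+_; ⌊_/2⌋; ⌈_/2⌉)
open import Data.Fin.Subset using (Subset; _─_; ∣_∣) renaming (_∪_ to _∪ᶠ_)
open import Data.Product using (_×_; _,_; ∃₂)
open import Relation.Binary.PropositionalEquality using (_≡_)
open import Relation.Unary using (Pred; _∈_; _⊆_; _∪_)

private
  variable
    d : ℕ
    ℓ ℓ₁ ℓ₂ : Level

-- A point of the hypercube is a subset of a d-element set, as a bit vector
-- (so that equality of subsets is ≡); a set of points is a predicate,
-- not assumed decidable.
Vertex : ℕ → Set
Vertex = Subset

infixr 6 _△_

_△_ : Vertex d → Vertex d → Vertex d
γ △ γ′ = (γ ─ γ′) ∪ᶠ (γ′ ─ γ)

dist : Vertex d → Vertex d → ℕ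
dist γ γ′ = ∣ γ △ γ′ ∣

m̂ : Vertex d → Vertex d → Pred (Vertex d) _
m̂ a b = (λ u → dist a u ≡ ⌊ dist a b /2⌋ × dist a u + dist u b ≡ dist a b)
      ∪ (λ u → dist a u ≡ ⌈ dist a b /2⌉ × dist a u + dist u b ≡ dist a b)

m̂ₛ : Pred (Vertex d) ℓ₁ → Pred (Vertex d) ℓ₂ → Pred (Vertex d) (ℓ₁ ⊔ ℓ₂)
m̂ₛ S T u = ∃₂ λ s t → s ∈ S × t ∈ T × u ∈ m̂ s t

Convex : Pred (Vertex d) ℓ → Set ℓ
Convex S = m̂ₛ S S ⊆ S

-- The intersection of all convex T ⊇ S. Quantifying over T : Pred _ ℓ raises
-- the level of the result; the three lemmas below show that it is nevertheless
-- convex, contains S, and is contained in every such T.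
convexClosure : Pred (Vertex d) ℓ → Pred (Vertex d) (suc ℓ)
convexClosure {d} {ℓ} S v = (T : Pred (Vertex d) ℓ) → Convex T → S ⊆ T → v ∈ T

convexClosure-convex : (S : Pred (Vertex d) ℓ) → Convex (convexClosure S)
convexClosure-convex S (s , t , s∈C , t∈C , u∈m̂) T cT S⊆T =
  cT (s , t , s∈C T cT S⊆T , t∈C T cT S⊆T , u∈m̂)

convexClosure-⊇ : (S : Pred (Vertex d) ℓ) → S ⊆ convexClosure S
convexClosure-⊇ S v∈S T cT S⊆T = S⊆T v∈S

convexClosure-least : (S T : Pred (Vertex d) ℓ) → Convex T → S ⊆ T →
                      convexClosure S ⊆ T
convexClosure-least S T cT S⊆T v∈C = v∈C T cT S⊆T

{-# OPTIONS --safe #-}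
-- Any two points a and b at distance n are opposite vertices of a quadrilateral
-- a, x, b, y whose diagonals both have length n, with d(a,x) = d(b,y) = ⌈n/2⌉
-- and d(x,b) = d(y,a) = ⌊n/2⌋: split the coordinates where a and b differ into
-- two halves, and flip in a one half to get x and the other half to get y.
-- Then x and y lie in m̂(a,b), while a and b lie in m̂(x,y).
module Submission where

open import Defs
open import Level using (Level)
open import Data.Bool.Base using (true; false)
open import Data.Fin.Subset using (∣_∣; _─_)
open import Data.Fin.Subset.Properties using (∪-comm)
open import Data.Nat.Base using (ℕ; suc; _+_; ⌊_/2⌋; ⌈_/2⌉)
open import Data.Nat.Properties using (+-comm; ⌊n/2⌋+⌈n/2⌉≡n)
open import Data.Product using (_×_; _,_; ∃₂)
open import Data.Sum.Base using (inj₁; inj₂)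
open import Data.Vec.Base using ([]; _∷_)
open import Relation.Binary.PropositionalEquality
  using (_≡_; refl; sym; trans; cong; cong₂)
open import Relation.Unary using (Pred; Satisfiable; _∈_; _⊆_; _∪_)

private
  variable
    d : ℕ
    ℓ : Level

dist-sym : (a b : Vertex d) → dist a b ≡ dist b a
dist-sym a b = cong ∣_∣ (∪-comm (a ─ b) (b ─ a))

-- Keeping `n` apart from `dist a b` lets both diagonals of a quadrilateral share the same side
-- lengths.
floor∈m̂ : ∀ {n} (a b u : Vertex d) → dist a b ≡ n →
          dist a u ≡ ⌊ n /2⌋ → dist u b ≡ ⌈ n /2⌉ → u ∈ m̂ a b
floor∈m̂ {n = n} a b u refl au ub =
  inj₁ (au , trans (cong₂ _+_ au ub) (⌊n/2⌋+⌈n/2⌉≡n n))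

ceil∈m̂ : ∀ {n} (a b u : Vertex d) → dist a b ≡ n →
         dist a u ≡ ⌈ n /2⌉ → dist u b ≡ ⌊ n /2⌋ → u ∈ m̂ a b
ceil∈m̂ {n = n} a b u refl au ub =
  inj₂ (au , trans (cong₂ _+_ au ub)
                   (trans (+-comm ⌈ n /2⌉ ⌊ n /2⌋) (⌊n/2⌋+⌈n/2⌉≡n n)))

Quadrilateral : (a x b y : Vertex d) → Set
Quadrilateral a x b y =
  dist a x ≡ ⌈ n /2⌉ × dist x b ≡ ⌊ n /2⌋ ×
  dist a y ≡ ⌊ n /2⌋ × dist y b ≡ ⌈ n /2⌉ × dist x y ≡ n
  where n = dist a b

-- At a coordinate where a and b differ, x and y trade places, which keeps the
-- two halves balanced: ⌈ suc n /2⌉ is suc ⌊ n /2⌋ and ⌊ suc n /2⌋ is ⌈ n /2⌉.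
quadrilateral : (a b : Vertex d) → ∃₂ λ x y → Quadrilateral a x b y
quadrilateral [] [] = [] , [] , refl , refl , refl , refl , refl
quadrilateral (s ∷ a) (t ∷ b) with quadrilateral a b
quadrilateral (false ∷ a) (false ∷ b) | x , y , q = false ∷ x , false ∷ y , q
quadrilateral (true ∷ a) (true ∷ b) | x , y , q = true ∷ x , true ∷ y , q
quadrilateral (false ∷ a) (true ∷ b) | x , y , ax , xb , ay , yb , xy =
  true ∷ y , false ∷ x ,
  cong suc ay , yb , ax , cong suc xb , cong suc (trans (dist-sym y x) xy)
quadrilateral (true ∷ a) (false ∷ b) | x , y , ax , xb , ay , yb , xy =
  false ∷ y , true ∷ x ,
  cong suc ay , yb , ax , cong suc xb , cong suc (trans (dist-sym y x) xy)

convex-⊇m̂⇒endpoints : (T : Pred (Vertex d) ℓ) → Convex T →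
                       (a b : Vertex d) → m̂ a b ⊆ T → a ∈ T × b ∈ T
convex-⊇m̂⇒endpoints T convex a b m̂⊆T
  with x , y , ax , xb , ay , yb , xy ← quadrilateral a b =
    -- When the distance is odd, `a` lies nearer to `y` and `b` nearer to `x`, so one needs the
    -- ceiling and the other the floor.
    convex (x , y , x∈T , y∈T , ceil∈m̂ x y a xy (trans (dist-sym x a) ax) ay) ,
    convex (x , y , x∈T , y∈T , floor∈m̂ x y b xy xb (trans (dist-sym b y) yb))
  where
  x∈T = m̂⊆T (ceil∈m̂ a b x refl ax xb)
  y∈T = m̂⊆T (floor∈m̂ a b y refl ay yb)

corollary3p4 : ∀ {ℓ : Level} (d : ℕ) (A B : Pred (Vertex d) ℓ) →
    Satisfiable A → Satisfiable B →
    (A ∪ B) ⊆ convexClosure (m̂ₛ A B)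
-- Nonemptiness of the other set supplies the opposite endpoint.
corollary3p4 d A B _ (b , b∈B) {a} (inj₁ a∈A) T convex m̂⊆T
  with a∈T , _ ← convex-⊇m̂⇒endpoints T convex a b
                   (λ u∈m̂ → m̂⊆T (a , b , a∈A , b∈B , u∈m̂)) = a∈T
corollary3p4 d A B (a , a∈A) _ {b} (inj₂ b∈B) T convex m̂⊆T
  with _ , b∈T ← convex-⊇m̂⇒endpoints T convex a b
                   (λ u∈m̂ → m̂⊆T (a , b , a∈A , b∈B , u∈m̂)) = b∈T
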